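{- Let $\mathbf{H}=(\mathcal{H}_1,\dots,\mathcal{H}_m)$ be a vector of multisort species in the sorts $(\mathcal{Z},\mathcal{Y}_1,\dots,\mathcal{Y}_m)$ such that $\mathbf{H}(\mathbf{0},\mathbf{0})=\mathbf{0}$. The combinatorial system $\mathbf{Y}=\mathbf{H}(\mathcal{Z},\mathbf{Y})$ is well founded at $\mathbf{0}$ if and only if the Jacobian matrix $\frac{\partial\mathbf{H}}{\partial\mathbf{Y}}(\mathbf{0},\mathbf{0})$ is nilpotent and the vector of species $\mathbf{Y}^{[m]}$ has no zero coordinate, where $\mathbf{Y}^{[0]}=\mathbf{0}$ and $\mathbf{Y}^{[n+1]}=\mathbf{H}(\mathcal{Z},\mathbf{Y}^{[n]})$ for $n\ge 0$.
   Context: A (multisort, $k$-sort) species $\mathcal{F}$ assigns to each $k$-tuple of finite sets $U=(U_1,\dots,U_k)$ a finite set $\mathcal{F}[U]$ of $\mathcal{F}$-structures and to each $k$-tuple of bijections $\sigma$ a bijection $\mathcal{F}[\sigma]$, compatibly with composition and identities; the size of a structure is $|U_1|+\dots+|U_k|$. Species are considered up to isomorphism (families of bijections commuting with transport). $0$ is the species with no structures. Sum is disjoint union; product $(\mathcal F\cdot\mathcal G)[U]=\bigsqcup_{U=U_1\sqcup U_2}\mathcal F[U_1]\times\mathcal G[U_2]$; composition $\mathcal F(\mathcal G_1,\dots,\mathcal G_k)$ (defined when no $\mathcal G_i$ has a structure on the empty set) has as structures on $U$ a partition of $U$ into blocks, each block assigned a sort $i$ and carrying a $\mathcal G_i$-structure,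 together with an $\mathcal F$-structure on the tuple of sets of blocks of each sort. Substituting $0$ for a sort keeps only the structures whose set of that sort is empty. The partial derivative is $\frac{\partial\mathcal F}{\partial\mathcal Y_i}[U]=\mathcal F[U_1,\dots,U_i\sqcup\{\star\},\dots,U_k]$; the Jacobian matrix $\frac{\partial\mathbf H}{\partial\mathbf Y}$ has entries $\frac{\partial\mathcal H_i}{\partial\mathcal Y_j}$, matrix products use species sums and products, and a matrix of species is nilpotent if some power of it is the zero matrix. For species $\mathcal F$, $\mathcal F_{\le p}$ is the restriction to structures of size $\le p$; $\mathcal F$ and $\mathcal G$ have contact of order $p$ if $\mathcal F_{\le p}\cong\mathcal G_{\le p}$; a sequence $(\mathcal Y^{[n]})$ converges to $\mathcal Y$ if for every $p$, $\mathcal Y^{[n]}$ has contact of order $p$ with $\mathcal Y$ for all large $n$ (componentwise for vectors). The system $\mathbf Y=\mathbf H(\mathcal Z,\mathbf Y)$ with $\mathbf H(\mathbf 0,\mathbf 0)=\mathbf 0$ is \emph{well founded at $\mathbf 0$} if the sequence $\mathbf Y^{[0]}=\mathbf 0$, $\mathbf Y^{[n+1]}=\mathbf H(\mathcal Z,\mathbf Y^{[n]})$ converges and its limit has no coordinate equal to the species $0$. -}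

module Defs where

open import Data.Nat using (ℕ; zero; suc; _+_; _≤_)
open import Data.Fin using (Fin; zero; suc; _≟_)
open import Data.Fin.Permutation using (↔⇒≡)
open import Data.Sum using (_⊎_; inj₁; inj₂)
open import Data.Product using (Σ; _×_; _,_; proj₁; proj₂; ∃; ∃-syntax)
open import Data.Empty using (⊥)
open import Data.Unit using (⊤; tt)
open import Function.Bundles using (_↔_; Inverse; mk↔ₛ′)
open import Function.Construct.Composition using (_↔-∘_)
open import Function.Construct.Symmetry using (↔-sym)
open import Relation.Binary.PropositionalEquality using (_≡_; refl; sym; trans; cong; subst)
open import Relation.Binary.Structures using (IsEquivalence)
open import Relation.Nullary using (¬_; Dec; yes; no)

-- Labels.  A k-tuple of finite sets is represented (up to the canonical
-- skeleton of the groupoid of finite sets and bijections) by a k-tuple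
-- of sizes n, the i-th set being Fin (n i).

Sizes : ℕ → Set
Sizes k = Fin k → ℕ

∑ : ∀ {k} → Sizes k → ℕ
∑ {zero}  n = 0
∑ {suc k} n = n zero + ∑ (λ i → n (suc i))

Relab : ∀ {k} → Sizes k → Sizes k → Set
Relab {k} n m = (i : Fin k) → Fin (n i) ↔ Fin (m i)

-- (Pre)species.  Structures form a setoid (so that constructions such as
-- product and substitution, whose structures are only defined up to the
-- relabelling of auxiliary data, need no quotient types); transport is
-- along k-tuples of bijections.

record Species (k : ℕ) : Set₁ where
  field
    Str : Sizes k → Set
    _≈_ : ∀ {n} → Str n → Str n → Set
    tr  : ∀ {n m} → Relab n m → Str n → Str m

open Species public

FiniteStr : ∀ {k} (F : Species k) (n : Sizes k) → Set
FiniteStr F n = Σ ℕ λ c → Σ (Str F n → Fin c) λ to → Σ (Fin c → Str F n) λ from →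
  (∀ x y → _≈_ F x y → to x ≡ to y) × (∀ x → _≈_ F (from (to x)) x) × (∀ i → to (from i) ≡ i)

record IsSpecies {k} (F : Species k) : Set where
  field
    equiv    : ∀ n → IsEquivalence (_≈_ F {n})
    tr-cong  : ∀ {n m} (σ : Relab n m) {x y : Str F n} → _≈_ F x y → _≈_ F (tr F σ x) (tr F σ y)
    tr-id    : ∀ {n} (σ : Relab n n) → (∀ i y → Inverse.to (σ i) y ≡ y) →
               ∀ x → _≈_ F (tr F σ x) x
    tr-comp  : ∀ {n m l} (σ : Relab n m) (τ : Relab m l) (ρ : Relab n l) →
               (∀ i y → Inverse.to (ρ i) y ≡ Inverse.to (τ i) (Inverse.to (σ i) y)) →
               ∀ x → _≈_ F (tr F ρ x) (tr F τ (tr F σ x))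
    finite   : ∀ n → FiniteStr F n

record IsoOn {k} (P : Sizes k → Set) (F G : Species k) : Set where
  field
    fwd      : ∀ n → P n → Str F n → Str G n
    bwd      : ∀ n → P n → Str G n → Str F n
    fwd-cong : ∀ n p {x y} → _≈_ F x y → _≈_ G (fwd n p x) (fwd n p y)
    bwd-cong : ∀ n p {x y} → _≈_ G x y → _≈_ F (bwd n p x) (bwd n p y)
    bwd-fwd  : ∀ n p x → _≈_ F (bwd n p (fwd n p x)) x
    fwd-bwd  : ∀ n p y → _≈_ G (fwd n p (bwd n p y)) y
    natural  : ∀ n m (p : P n) (q : P m) (σ : Relab n m) x →
               _≈_ G (tr G σ (fwd n p x)) (fwd m q (tr F σ x))

_≅_ : ∀ {k} → Species k → Species k → Set
F ≅ G = IsoOn (λ _ → ⊤) F G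

Contact : ∀ {k} → ℕ → Species k → Species k → Set
Contact p F G = IsoOn (λ n → ∑ n ≤ p) F G

𝟘 : ∀ {k} → Species k
𝟘 = record { Str = λ _ → ⊥ ; _≈_ = λ _ _ → ⊤ ; tr = λ _ () }

private
  fin0 : ∀ {a b} → Fin a ↔ Fin b → a ≡ 0 → b ≡ 0
  fin0 σ refl = sym (↔⇒≡ σ)

  fin1 : ∀ {a b} → Fin a ↔ Fin b → a ≡ 1 → b ≡ 1
  fin1 σ refl = sym (↔⇒≡ σ)

𝟙 : ∀ {k} → Species k
𝟙 = record
  { Str = λ n → ∀ i → n i ≡ 0
  ; _≈_ = λ _ _ → ⊤
  ; tr  = λ σ e i → fin0 (σ i) (e i) }

𝒵 : Species 1
𝒵 = record
  { Str = λ n → n zero ≡ 1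
  ; _≈_ = λ _ _ → ⊤
  ; tr  = λ σ e → fin1 (σ zero) e }

data SumRel {A B : Set} (RA : A → A → Set) (RB : B → B → Set) : A ⊎ B → A ⊎ B → Set where
  inj₁ : ∀ {x y} → RA x y → SumRel RA RB (inj₁ x) (inj₁ y)
  inj₂ : ∀ {x y} → RB x y → SumRel RA RB (inj₂ x) (inj₂ y)

_⊕_ : ∀ {k} → Species k → Species k → Species k
F ⊕ G = record
  { Str = λ n → Str F n ⊎ Str G n
  ; _≈_ = SumRel (_≈_ F) (_≈_ G)
  ; tr  = λ { σ (inj₁ x) → inj₁ (tr F σ x) ; σ (inj₂ y) → inj₂ (tr G σ y) } }

-- product : a splitting U_i = U_i¹ ⊔ U_i² of every sort, given by a
-- bijection Fin (n i) ↔ Fin (a i) ⊎ Fin (b i), with an F-structure on the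
-- first parts and a G-structure on the second parts; two such data are
-- identified when they differ by a relabelling of the parts.
record ProdStr {k} (F G : Species k) (n : Sizes k) : Set where
  constructor prod
  field
    a b   : Sizes k
    split : (i : Fin k) → Fin (n i) ↔ (Fin (a i) ⊎ Fin (b i))
    f     : Str F a
    g     : Str G b

⊎-map : ∀ {A B C D : Set} → (A → C) → (B → D) → A ⊎ B → C ⊎ D
⊎-map f g (inj₁ x) = inj₁ (f x)
⊎-map f g (inj₂ y) = inj₂ (g y)

ProdRel : ∀ {k} (F G : Species k) {n} → ProdStr F G n → ProdStr F G n → Set
ProdRel {k} F G (prod a b s f g) (prod a' b' s' f' g') =
  Σ (Relab a a') λ α → Σ (Relab b b') λ β →
    (∀ (i : Fin k) x → Inverse.to (s' i) x ≡ ⊎-map (Inverse.to (α i)) (Inverse.to (β i)) (Inverse.to (s i) x))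
    × _≈_ F (tr F α f) f' × _≈_ G (tr G β g) g'

_⊗_ : ∀ {k} → Species k → Species k → Species k
F ⊗ G = record
  { Str = ProdStr F G
  ; _≈_ = ProdRel F G
  ; tr  = λ { σ (prod a b s f g) → prod a b (λ i → s i ↔-∘ ↔-sym (σ i)) f g } }

Σˢ : ∀ {k m} → (Fin m → Species k) → Species k
Σˢ {m = zero}  F = 𝟘
Σˢ {m = suc m} F = F zero ⊕ Σˢ (λ i → F (suc i))

-- composition F(G_1,...,G_k), F a k-sort species, G_i l-sort species.
-- A structure on the l-tuple of sizes n: for each sort i of F a number b i
-- of blocks of sort i; for each block t of sort i its l-tuple of sizes
-- m i t; a partition of the labels of each sort j into the blocks
-- (a bijection of Fin (n j) with the disjoint union of the parts of sort j
-- of all the blocks); an F-structure on the tuple of sets of blocks; and a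
-- G_i-structure on every block of sort i.  Data differing by a relabelling
-- of the blocks and of the labels inside the blocks are identified.
record CompStr {k l} (F : Species k) (G : Fin k → Species l) (n : Sizes l) : Set where
  constructor comp
  field
    b    : Sizes k
    m    : (i : Fin k) → Fin (b i) → Sizes l
    part : (j : Fin l) → Fin (n j) ↔ Σ (Fin k) (λ i → Σ (Fin (b i)) (λ t → Fin (m i t j)))
    f    : Str F b
    g    : (i : Fin k) (t : Fin (b i)) → Str (G i) (m i t)

CompRel : ∀ {k l} (F : Species k) (G : Fin k → Species l) {n} → CompStr F G n → CompStr F G n → Set
CompRel {k} {l} F G (comp b m p f g) (comp b' m' p' f' g') =
  Σ (Relab b b') λ α →
  Σ ((i : Fin k) (t : Fin (b i)) → Relab (m i t) (m' i (Inverse.to (α i) t))) λ ρ →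
    (∀ (j : Fin l) x → Inverse.to (p' j) x ≡
       (let (i , t , y) = Inverse.to (p j) x
        in (i , Inverse.to (α i) t , Inverse.to (ρ i t j) y)))
    × _≈_ F (tr F α f) f'
    × (∀ i t → _≈_ (G i) (tr (G i) (ρ i t) (g i t)) (g' i (Inverse.to (α i) t)))

_∘ˢ_ : ∀ {k l} → Species k → (Fin k → Species l) → Species l
F ∘ˢ G = record
  { Str = CompStr F G
  ; _≈_ = CompRel F G
  ; tr  = λ { σ (comp b m p f g) → comp b m (λ j → p j ↔-∘ ↔-sym (σ j)) f g } }

-- substituting 0 for all the sorts: keep the structures on the empty tuple
at0 : ∀ {k} → Species k → Species k
at0 F = record
  { Str = λ n → (∀ i → n i ≡ 0) × Str F n
  ; _≈_ = λ x y → _≈_ F (proj₂ x) (proj₂ y)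
  ; tr  = λ σ x → (λ i → fin0 (σ i) (proj₁ x i)) , tr F σ (proj₂ x) }

-- partial derivative with respect to sort i : add one extra label ⋆
-- (represented as zero : Fin (suc _)) to the set of sort i.
bumpD : ∀ {A : Set} → Dec A → ℕ → ℕ
bumpD (yes _) x = suc x
bumpD (no _)  x = x

bump : ∀ {k} → Fin k → Sizes k → Sizes k
bump i n j = bumpD (i ≟ j) (n j)

private
  liftF : ∀ {a b} → Fin a ↔ Fin b → Fin (suc a) ↔ Fin (suc b)
  liftF {a} {b} σ = mk↔ₛ′ to from inl inr
    where
      to : Fin (suc a) → Fin (suc b)
      to zero = zero
      to (suc x) = suc (Inverse.to σ x)
      from : Fin (suc b) → Fin (suc a)
      from zero = zero
      from (suc y) = suc (Inverse.from σ y)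
      inl : ∀ y → to (from y) ≡ y
      inl zero = refl
      inl (suc y) = cong suc (Inverse.strictlyInverseˡ σ y)
      inr : ∀ x → from (to x) ≡ x
      inr zero = refl
      inr (suc x) = cong suc (Inverse.strictlyInverseʳ σ x)

  liftD : ∀ {A : Set} (d : Dec A) {a b} → Fin a ↔ Fin b → Fin (bumpD d a) ↔ Fin (bumpD d b)
  liftD (yes _) σ = liftF σ
  liftD (no _)  σ = σ

∂ : ∀ {k} → Fin k → Species k → Species k
∂ i F = record
  { Str = λ n → Str F (bump i n)
  ; _≈_ = _≈_ F
  ; tr  = λ σ x → tr F (λ j → liftD (i ≟ j) (σ j)) x }

Mat : ℕ → ℕ → Set₁
Mat k m = Fin m → Fin m → Species k

_·ᴹ_ : ∀ {k m} → Mat k m → Mat k m → Mat k m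
(A ·ᴹ B) i j = Σˢ (λ l → A i l ⊗ B l j)

idᴹ : ∀ {k m} → Mat k m
idᴹ i j with i ≟ j
... | yes _ = 𝟙
... | no _  = 𝟘

_^ᴹ_ : ∀ {k m} → Mat k m → ℕ → Mat k m
A ^ᴹ zero  = idᴹ
A ^ᴹ suc p = A ·ᴹ (A ^ᴹ p)

Nilpotent : ∀ {k m} → Mat k m → Set
Nilpotent A = ∃[ p ] (∀ i j → (A ^ᴹ p) i j ≅ 𝟘)

-- The system Y = H(Z, Y).  H is a vector of m species in the m+1 sorts
-- (Z, Y_1, ..., Y_m), sort Z being zero : Fin (suc m) and Y_i being suc i.

args : ∀ {m} → (Fin m → Species 1) → Fin (suc m) → Species 1
args Y zero    = 𝒵
args Y (suc i) = Y i

iter : ∀ {m} → (Fin m → Species (suc m)) → ℕ → Fin m → Species 1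
iter H zero    i = 𝟘
iter H (suc n) i = H i ∘ˢ args (iter H n)

jacobian0 : ∀ {m} → (Fin m → Species (suc m)) → Mat (suc m) m
jacobian0 H i j = at0 (∂ (suc j) (H i))

Converges : ∀ {m} → (ℕ → Fin m → Species 1) → (Fin m → Species 1) → Set
Converges Ys Y = ∀ i (p : ℕ) → ∃[ N ] (∀ n → N ≤ n → Contact p (Ys n i) (Y i))

NoZeroCoord : ∀ {k m} → (Fin m → Species k) → Set
NoZeroCoord Y = ∀ i → ¬ (Y i ≅ 𝟘)

WellFoundedAt0 : ∀ {m} → (Fin m → Species (suc m)) → Set₁
WellFoundedAt0 H = Σ (_ → Species 1) λ Y →
  (∀ i → IsSpecies (Y i)) × Converges (iter H) Y × NoZeroCoord Y

{-# OPTIONS --safe #-}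

-- A structure of Y^[n] is a tree of height at most n whose nodes carry H-structures, so the only
-- possible limit is the species of all such trees. J = ∂H/∂Y(0,0) is the adjacency matrix of the
-- graph of those pairs (i, j) for which H_i has a structure on a single label of sort Y_j.
--
-- If J^q = 0, a tree with k labels has height at most q + qk: as H(0,0) = 0, every subtree owns a
-- label, so going down either loses a label or follows an edge of the graph. Hence there are
-- finitely many trees of each size, and Y^[n] contains all those with k labels once n ≥ q + qk.
--
-- Conversely, grafting a tree repeatedly around a cycle of the graph gives trees of the same size
-- and unbounded height, against the finiteness of the limit. Finally, the set of coordinates where
-- Y^[n+1] is nonzero depends only on the one for Y^[n] and grows with n, so it is stationary from
-- some n ≤ m on. That set is not decidable, but the conclusion is negative, so it can be treated
-- as if it were.

module Submission where

open import Defs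
open import Data.Nat using (ℕ; zero; suc; _+_; _*_; _⊔_; _≤_; _<_; s≤s)
import Data.Nat.Properties as ℕP
open import Data.Fin as Fin using (Fin; zero; suc; toℕ)
open import Data.Fin.Permutation using (↔⇒≡)
open import Data.Fin.Properties using (any?; injective⇒≤; pigeonhole; toℕ≤pred[n]; +↔⊎)
open import Data.List using (List; []; _∷_; concatMap; allFin; upTo)
open import Data.List.Membership.Propositional using (_∈_; lose; find)
open import Data.List.Membership.Propositional.Properties using (∈-concatMap⁺; ∈-allFin; ∈-upTo⁺)
import Data.List.Relation.Unary.All as All
open import Data.List.Relation.Unary.Any as Any using (here; there)
open import Data.Product using (Σ; ∃; _×_; _,_; proj₁; proj₂; uncurry)
open import Data.Product.Function.Dependent.Propositional using () renaming (cong to Σ-cong)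
open import Data.Product.Properties using (≡-dec)
open import Data.Sum using (_⊎_; inj₁; inj₂; swap)
open import Data.Empty using (⊥)
open import Data.Unit using (⊤; tt)
open import Function.Base using (_∘_)
open import Function.Bundles using (_↔_; _⇔_; Inverse; mk↔ₛ′; mk⇔)
open import Function.Construct.Composition using (_↔-∘_)
open import Function.Construct.Identity using (↔-id)
open import Function.Construct.Symmetry using (↔-sym)
open import Relation.Binary.Definitions using (DecidableEquality)
open import Relation.Binary.PropositionalEquality using (_≡_; refl; sym; trans; cong; subst; module ≡-Reasoning)
open import Relation.Binary.Structures using (IsEquivalence)
open import Relation.Nullary using (¬_; Dec; yes; no; contradiction)
open import Relation.Nullary.Decidable using (map′; _×-dec_; ¬?; decidable-stable)

open Inverse using (to; from; strictlyInverseˡ; strictlyInverseʳ)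

-- Finite search

-- The relation U lets a cover be computed stepwise: each choice in a bind narrows D to the
-- elements compatible with it, and the last one produces E.
Cover : (D E : Set) → (D → E → Set) → Set
Cover D E U = Σ (List E) λ L → ∀ d → Σ E λ e → e ∈ L × U d e

module _ {D E : Set} {U : D → E → Set} where

  coverOne : (e : E) → (∀ d → U d e) → Cover D E U
  coverOne e u = e ∷ [] , λ d → e , here refl , u d

  coverNone : ¬ D → Cover D E U
  coverNone ¬d = [] , λ d → contradiction d ¬d

  _>>=_ : ∀ {C : Set} {T : D → C → Set} → Cover D C T →
          (∀ c → Cover (Σ D λ d → T d c) E (U ∘ proj₁)) → Cover D E U
  _>>=_ {C} {T} (L , cov) k = concatMap (proj₁ ∘ k) L , λ d →
    let (c , c∈L , t) = cov d
        (e , e∈ , u)  = proj₂ (k c) (d , t)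
    in e , ∈-concatMap⁺ (proj₁ ∘ k) (lose c∈L e∈) , u

  restrictCover : ∀ {D' : Set} {U' : D' → E → Set} (h : D' → D) →
                  (∀ d e → U (h d) e → U' d e) → Cover D E U → Cover D' E U'
  restrictCover h w (L , cov) = L , λ d →
    let (e , e∈L , u) = cov (h d) in e , e∈L , w d e u

-- Because `P` is invariant along `R`, any witness can be replaced by a member of the list, so
-- testing the list settles existence.
search : ∀ {A : Set} {R : A → A → Set} {P : A → Set} → Cover A A R →
         (∀ {a a'} → R a a' → P a → P a') → (∀ a → Dec (P a)) → Dec (Σ A P)
search {P = P} (L , cov) resp P? = map′
  (λ any → let (a , _ , p) = find any in a , p)
  (λ { (a , p) → let (a' , a'∈L , r) = cov a in lose a'∈L (resp r p) })
  (Any.any? P? L)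

-- `choose` is finite choice for covers, made a field because it passes to `Σ`-types by currying.
-- Its results are compared pointwise, since pointwise equal functions need not be propositionally
-- equal.
record Finite (A : Set) : Set₁ where
  field
    elements : Cover A A _≡_
    _≟_      : DecidableEquality A
    choose   : ∀ {D : Set} {B : A → Set} {R : ∀ a → D → B a → Set} →
               (∀ a → Cover D (B a) (R a)) → Cover D (∀ a → B a) (λ d f → ∀ a → R a d (f a))

  forall? : ∀ {P : A → Set} → (∀ a → Dec (P a)) → Dec (∀ a → P a)
  forall? {P} P? = map′
    (λ all a → let (a' , a'∈L , e) = proj₂ elements a in subst P (sym e) (All.lookup all a'∈L))
    (λ p → All.tabulate (λ {a} _ → p a))
    (All.all? P? (proj₁ elements))

chooseFin : ∀ n {D : Set} {B : Fin n → Set} {R : ∀ i → D → B i → Set} →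
            (∀ i → Cover D (B i) (R i)) → Cover D (∀ i → B i) (λ d f → ∀ i → R i d (f i))
chooseFin zero    c = coverOne (λ ()) (λ _ ())
chooseFin (suc n) {B = B} {R} c =
  c zero >>= λ b → restrictCover proj₁ (λ _ _ u → u) (chooseFin n (c ∘ suc)) >>= λ f →
  coverOne (cons b f) λ { ((d , u) , v) → λ { zero → u ; (suc i) → v i } }
  where
    cons : B zero → (∀ i → B (suc i)) → ∀ i → B i
    cons b f zero    = b
    cons b f (suc i) = f i

finiteFin : ∀ n → Finite (Fin n)
finiteFin n = record
  { elements = allFin n , λ i → i , ∈-allFin i , refl
  ; _≟_      = Fin._≟_
  ; choose   = chooseFin n }

finiteΣ : ∀ {A : Set} {B : A → Set} → Finite A → (∀ a → Finite (B a)) → Finite (Σ A B)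
finiteΣ FA FB = record
  { elements = restrictCover {U' = λ d a → proj₁ d ≡ a} proj₁ (λ _ _ e → e) (elements FA) >>= λ a →
               restrictCover (λ { ((_ , b) , refl) → b }) (λ _ _ e → e) (elements (FB a)) >>= λ b →
               coverOne (a , b) (λ { (((_ , _) , refl) , refl) → refl })
  ; _≟_      = ≡-dec (_≟_ FA) (λ {a} → _≟_ (FB a))
  ; choose   = λ c → choose FA (λ a → choose (FB a) (λ b → c (a , b))) >>= λ f →
               coverOne (uncurry f) (λ { (d , u) (a , b) → u a b }) }
  where open Finite

-- Both directions are enumerated independently. A pair of functions that fails to be mutually
-- inverse matches no bijection, so it contributes nothing to the cover.
finite↔ : ∀ {A B : Set} → Finite A → Finite B →
          Cover (A ↔ B) (A ↔ B) (λ σ τ → ∀ x → to σ x ≡ to τ x)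
finite↔ {A} {B} FA FB =
  choose FA (λ a → restrictCover (λ σ → to σ a) (λ _ _ e → e) (elements FB)) >>= λ f →
  choose FB (λ b → restrictCover (λ σ → from (proj₁ σ) b) (λ _ _ e → e) (elements FA)) >>= λ g →
  bijection f g (forall? FB (λ b → _≟_ FB (f (g b)) b)) (forall? FA (λ a → _≟_ FA (g (f a)) a))
  where
    open Finite
    bijection : (f : A → B) (g : B → A) → Dec (∀ b → f (g b) ≡ b) → Dec (∀ a → g (f a) ≡ a) →
      Cover (Σ (Σ (A ↔ B) λ σ → ∀ a → to σ a ≡ f a) λ σ → ∀ b → from (proj₁ σ) b ≡ g b)
            (A ↔ B) (λ σ τ → ∀ x → to (proj₁ (proj₁ σ)) x ≡ to τ x)
    bijection f g (yes l) (yes r) = coverOne (mk↔ₛ′ f g l r) (λ { ((σ , p) , q) → p })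
    bijection f g (no ¬l) _       = coverNone λ { ((σ , p) , q) → ¬l λ b →
      trans (cong f (sym (q b))) (trans (sym (p _)) (strictlyInverseˡ σ b)) }
    bijection f g (yes _) (no ¬r) = coverNone λ { ((σ , p) , q) → ¬r λ a →
      trans (cong g (sym (p a))) (trans (sym (q _)) (strictlyInverseʳ σ a)) }

module _ {A : Set} {_~_ : A → A → Set} (equiv : IsEquivalence _~_) (_~?_ : ∀ x y → Dec (x ~ y)) where
  open IsEquivalence equiv renaming (refl to ~-refl; sym to ~-sym; trans to ~-trans)

  -- Greedy selection: an element is kept only if it is inequivalent to everything kept so far.
  representatives : (L : List A) → Σ ℕ λ c → Σ (Fin c → A) λ r →
    (∀ i j → r i ~ r j → i ≡ j) × (∀ {x} → x ∈ L → Σ (Fin c) λ i → x ~ r i)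
  representatives [] = 0 , (λ ()) , (λ ()) , λ ()
  representatives (x ∷ L) with representatives L
  ... | c , r , inj , cov with any? (λ i → x ~? r i)
  ...   | yes old = c , r , inj , λ { (here refl) → old ; (there x∈L) → cov x∈L }
  ...   | no new  = suc c , r' , inj' , λ { (here refl) → zero , ~-refl
                                          ; (there y∈L) → let (i , e) = cov y∈L in suc i , e }
    where
      r' : Fin (suc c) → A
      r' zero    = x
      r' (suc i) = r i
      inj' : ∀ i j → r' i ~ r' j → i ≡ j
      inj' zero    zero    _ = refl
      inj' zero    (suc j) e = contradiction (j , e) new
      inj' (suc i) zero    e = contradiction (i , ~-sym e) new
      inj' (suc i) (suc j) e = cong suc (inj i j e)

  -- The conclusion has the shape of `FiniteStr`: the classes are numbered by their chosen
  -- representatives.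
  finiteQuotient : Cover A A _~_ → Σ ℕ λ c → Σ (A → Fin c) λ f → Σ (Fin c → A) λ r →
    (∀ x y → x ~ y → f x ≡ f y) × (∀ x → r (f x) ~ x) × (∀ i → f (r i) ≡ i)
  finiteQuotient (L , cov) with representatives L
  ... | c , r , inj , covL = c , class , r , class-cong , (λ x → ~-sym (x~class x)) ,
                             λ i → inj _ _ (~-sym (x~class (r i)))
    where
      index : ∀ x → Σ (Fin c) λ i → x ~ r i
      index x = let (y , y∈L , x~y) = cov x ; (i , y~i) = covL y∈L in i , ~-trans x~y y~i
      class : A → Fin c
      class x = proj₁ (index x)
      x~class : ∀ x → x ~ r (class x)
      x~class x = proj₂ (index x)
      class-cong : ∀ x y → x ~ y → class x ≡ class y
      class-cong x y x~y = inj _ _ (~-trans (~-sym (x~class x)) (~-trans x~y (x~class y)))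

-- Trees

module SpeciesProperties {k} {F : Species k} (isSpecies : IsSpecies F) where
  open IsSpecies isSpecies public
  module ≈ {n} = IsEquivalence (equiv n)

  idᴿ : ∀ {n : Sizes k} → Relab n n
  idᴿ j = ↔-id _

  tr-idᴿ : ∀ {n} (x : Str F n) → _≈_ F (tr F idᴿ x) x
  tr-idᴿ = tr-id idᴿ (λ _ _ → refl)

  tr-resp : ∀ {n l} {σ τ : Relab n l} → (∀ j x → to (σ j) x ≡ to (τ j) x) →
            ∀ x → _≈_ F (tr F σ x) (tr F τ x)
  tr-resp {σ = σ} {τ} e x = ≈.trans (tr-comp τ idᴿ σ e x) (tr-idᴿ _)

  tr-inv : ∀ {n l} {σ : Relab n l} {τ : Relab l n} → (∀ j x → to (τ j) (to (σ j) x) ≡ x) →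
           ∀ {x y} → _≈_ F (tr F σ x) y → _≈_ F (tr F τ y) x
  tr-inv {σ = σ} {τ} e {x} {y} eq = ≈.trans (tr-cong τ (≈.sym eq))
    (≈.trans (≈.sym (tr-comp σ τ idᴿ (λ j z → sym (e j z)) x)) (tr-idᴿ x))

module Trees {m : ℕ} (H : Fin m → Species (suc m)) (isSpecies : ∀ i → IsSpecies (H i)) where

  module HS (i : Fin m) = SpeciesProperties (isSpecies i)

  Blocks : (b : Sizes (suc m)) → (∀ j → Fin (b j) → ℕ) → Set
  Blocks b μ = Σ (Fin (suc m)) λ j → Σ (Fin (b j)) λ t → Fin (μ j t)

  -- A `node` is a structure of `H i ∘ˢ args Y` whose blocks carry trees again. Since `𝒵` is the
  -- only sort of labels, a size is a plain number instead of a function on `Fin 1`, for which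
  -- equality would be only pointwise.
  data Tree : Fin (suc m) → ℕ → Set where
    atom : ∀ {k} → k ≡ 1 → Tree zero k
    node : ∀ {i k} (b : Sizes (suc m)) (μ : ∀ j → Fin (b j) → ℕ) (p : Fin k ↔ Blocks b μ)
           (f : Str (H i) b) (g : ∀ j t → Tree j (μ j t)) → Tree (suc i) k

  -- Het σ T T' : transporting T along σ gives T', up to relabelling of the blocks.
  data Het : ∀ {i k k'} → Fin k ↔ Fin k' → Tree i k → Tree i k' → Set where
    atom : ∀ {k k'} {σ : Fin k ↔ Fin k'} {e e'} → Het σ (atom e) (atom e')
    node : ∀ {i k k'} {σ : Fin k ↔ Fin k'} {b μ p f g b' μ' p' f' g'}
           (α : Relab b b') →
           _≈_ (H i) (tr (H i) α f) f' →
           (∀ j t → Σ (Fin (μ j t) ↔ Fin (μ' j (to (α j) t))) λ ρ →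
             (∀ y → to p' (to σ (from p (j , t , y))) ≡ (j , to (α j) t , to ρ y))
             × Het ρ (g j t) (g' j (to (α j) t))) →
           Het σ (node {i} b μ p f g) (node b' μ' p' f' g')

  -- The datum that `Het` attaches to a block, with the target `t'` left free so that it can be
  -- transported along equations between blocks.
  Block : ∀ {k k'} (σ : Fin k ↔ Fin k') {b μ} (p : Fin k ↔ Blocks b μ) (g : ∀ j t → Tree j (μ j t))
          {b' μ'} (p' : Fin k' ↔ Blocks b' μ') (g' : ∀ j t → Tree j (μ' j t)) →
          ∀ j → Fin (b j) → Fin (b' j) → Set
  Block σ {μ = μ} p g {μ' = μ'} p' g' j t t' = Σ (Fin (μ j t) ↔ Fin (μ' j t')) λ ρ →
    (∀ y → to p' (to σ (from p (j , t , y))) ≡ (j , t' , to ρ y)) × Het ρ (g j t) (g' j t')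

  het-node : ∀ {i k k'} {σ : Fin k ↔ Fin k'} {b μ p f g p' f' g'} →
             (∀ z → to p' (to σ (from p z)) ≡ z) → _≈_ (H i) f f' →
             (∀ j t → Het (↔-id _) (g j t) (g' j t)) →
             Het σ (node {i} b μ p f g) (node b μ p' f' g')
  het-node {i} e f≈f' hs = node idᴿ (≈.trans (tr-idᴿ _) f≈f') λ j t → ↔-id _ , (λ y → e _) , hs j t
    where open HS i

  het-refl : ∀ {i k} {σ : Fin k ↔ Fin k} → (∀ x → to σ x ≡ x) → (T : Tree i k) → Het σ T T
  het-refl e (atom _) = atom
  het-refl {suc i} e (node b μ p f g) =
    het-node (λ z → trans (cong (to p) (e _)) (strictlyInverseˡ p z)) ≈.refl
             (λ j t → het-refl (λ _ → refl) (g j t))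
    where open HS i

  het-trans : ∀ {i k k' k''} {σ : Fin k ↔ Fin k'} {τ : Fin k' ↔ Fin k''} {υ : Fin k ↔ Fin k''} {T T' T''} →
              (∀ x → to υ x ≡ to τ (to σ x)) → Het {i} σ T T' → Het τ T' T'' → Het υ T T''
  het-trans e atom atom = atom
  het-trans {suc i} {σ = σ} {τ} {υ} e (node {p = p} {p' = p'} α f~ h) (node {p' = p''} β f~' h') =
    node (λ j → β j ↔-∘ α j)
         (≈.trans (tr-comp α β _ (λ _ _ → refl) _) (≈.trans (tr-cong β f~) f~'))
         λ j t → let (ρ , q , r) = h j t ; (ρ' , q' , r') = h' j (to (α j) t) in
           ρ' ↔-∘ ρ ,
           (λ y → trans (cong (to p'') (trans (e _) (cong (to τ)
                     (trans (sym (strictlyInverseʳ p' _)) (cong (from p') (q y))))))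
                   (q' (to ρ y))) ,
           het-trans (λ _ → refl) r r'
    where open HS i

  het-sym : ∀ {i k k'} {σ : Fin k ↔ Fin k'} {τ : Fin k' ↔ Fin k} {T T'} →
            (∀ x → to τ (to σ x) ≡ x) → Het {i} σ T T' → Het τ T' T
  het-sym e atom = atom
  het-sym {suc i} {σ = σ} {τ} e (node {p = p} {g = g} {p' = p'} {g' = g'} α f~ h) =
    node (λ j → ↔-sym (α j)) (tr-inv (λ j x → strictlyInverseʳ (α j) x) f~)
         λ j t' → subst (λ t'' → Block τ p' g' p g j t'' (from (α j) t')) (strictlyInverseˡ (α j) t')
                        (flipped j (from (α j) t'))
    where
      open HS i
      flipped : ∀ j t → Block τ p' g' p g j (to (α j) t) t
      flipped j t = let (ρ , q , r) = h j t in
        ↔-sym ρ ,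
        (λ y' → let y = from ρ y' in begin
          to p (to τ (from p' (j , to (α j) t , y')))
            ≡⟨ cong (λ y' → to p (to τ (from p' (j , to (α j) t , y')))) (sym (strictlyInverseˡ ρ y')) ⟩
          to p (to τ (from p' (j , to (α j) t , to ρ y)))
            ≡⟨ cong (λ z → to p (to τ (from p' z))) (sym (q y)) ⟩
          to p (to τ (from p' (to p' (to σ (from p (j , t , y))))))
            ≡⟨ cong (λ x → to p (to τ x)) (strictlyInverseʳ p' _) ⟩
          to p (to τ (to σ (from p (j , t , y))))
            ≡⟨ cong (to p) (e _) ⟩
          to p (from p (j , t , y))
            ≡⟨ strictlyInverseˡ p _ ⟩
          (j , t , y) ∎) ,
        het-sym (λ x → strictlyInverseʳ ρ x) r
        where open ≡-Reasoning

  het-equiv : ∀ {i k} → IsEquivalence (Het {i} {k} (↔-id _))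
  het-equiv = record
    { refl  = het-refl (λ _ → refl) _
    ; sym   = het-sym (λ _ → refl)
    ; trans = het-trans (λ _ → refl) }

  module ≈ᵀ {i k} = IsEquivalence (het-equiv {i} {k})

  het-resp : ∀ {i k k'} {σ τ : Fin k ↔ Fin k'} {T T'} → (∀ x → to σ x ≡ to τ x) →
             Het {i} σ T T' → Het τ T T'
  het-resp e h = het-trans {τ = ↔-id _} (λ x → sym (e x)) h ≈ᵀ.refl

  -- Only the partition at the root changes: each subtree numbers its own labels independently.
  trᵀ : ∀ {i k k'} → Fin k ↔ Fin k' → Tree i k → Tree i k'
  trᵀ σ (atom e)         = atom (trans (sym (↔⇒≡ σ)) e)
  trᵀ σ (node b μ p f g) = node b μ (p ↔-∘ ↔-sym σ) f g

  het-tr : ∀ {i k k'} (σ : Fin k ↔ Fin k') (T : Tree i k) → Het σ T (trᵀ σ T)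
  het-tr σ (atom e) = atom
  het-tr {suc i} σ (node b μ p f g) =
    het-node (λ z → trans (cong (to p) (strictlyInverseʳ σ _)) (strictlyInverseˡ p z)) ≈.refl
             (λ _ _ → ≈ᵀ.refl)
    where open HS i

  -- abstract: conversion checking would otherwise compare these bijections field by field.
  abstract
    relabelParts : ∀ {k b b' μ μ'} (β : Relab b' b) → (∀ j t → Fin (μ' j t) ↔ Fin (μ j (to (β j) t))) →
                   Fin k ↔ Blocks b μ → Fin k ↔ Blocks b' μ'
    relabelParts β θ p = ↔-sym (Σ-cong (↔-id _) (λ {j} → Σ-cong (β j) (λ {t} → θ j t))) ↔-∘ p

    relabelParts-from : ∀ {k b b' μ μ'} (β : Relab b' b) (θ : ∀ j t → Fin (μ' j t) ↔ Fin (μ j (to (β j) t)))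
                        (p : Fin k ↔ Blocks b μ) j t y →
                        from (relabelParts {μ' = μ'} β θ p) (j , t , y) ≡ from p (j , to (β j) t , to (θ j t) y)
    relabelParts-from _ _ _ _ _ _ = refl

  -- Renaming the blocks and the labels inside them stays within the isomorphism class; this later
  -- brings a tree to prescribed block counts and sizes.
  relabel : ∀ {i k b b' μ μ'} p f g (β : Relab b' b) (θ : ∀ j t → Fin (μ' j t) ↔ Fin (μ j (to (β j) t))) →
            Het (↔-id _)
              (node {i} {k} b' μ' (relabelParts β θ p) (tr (H i) (λ j → ↔-sym (β j)) f)
                    (λ j t → trᵀ (↔-sym (θ j t)) (g j (to (β j) t))))
              (node b μ p f g)
  relabel {i} {μ' = μ'} p f g β θ =
    node β (tr-inv (λ j x → strictlyInverseˡ (β j) x) ≈.refl)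
         λ j t → θ j t , (λ y → trans (cong (to p) (relabelParts-from {μ' = μ'} β θ p j t y)) (strictlyInverseˡ p _)) ,
                 het-sym (λ x → strictlyInverseˡ (θ j t) x) (het-tr _ _)
    where open HS i

  -- The bijections `α` and `ρ` range over finite sets and the conditions on them respect pointwise
  -- equality, so both can be searched for. Equivalence of `H`-structures is decided by comparing
  -- their numbers in `finite`.
  het? : ∀ {i k k'} (σ : Fin k ↔ Fin k') (T : Tree i k) (T' : Tree i k') → Dec (Het σ T T')
  het? σ (atom _) (atom _) = yes atom
  het? {suc i} σ (node b μ p f g) (node b' μ' p' f' g') = map′
    (λ { (α , f~ , h) → node α f~ h })
    (λ { (node α f~ h) → α , f~ , h })
    (search (chooseFin (suc m) λ j → restrictCover (λ α → α j) (λ _ _ u → u) (finite↔ (finiteFin _) (finiteFin _)))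
      (λ e (f~ , h) → ≈.trans (≈.sym (tr-resp e f)) f~ ,
                      λ j t → subst (Block σ p g p' g' j t) (e j t) (h j t))
      λ α → ≈? (tr (H i) α f) f' ×-dec
            Finite.forall? (finiteFin _) λ j → Finite.forall? (finiteFin _) λ t →
            search (finite↔ (finiteFin _) (finiteFin _))
              (λ e (q , h) → (λ y → trans (q y) (cong (λ y → j , to (α j) t , y) (e y))) , het-resp e h)
              λ ρ → Finite.forall? (finiteFin _) (λ y → Finite._≟_ finiteBlocks _ _)
                    ×-dec het? ρ (g j t) (g' j (to (α j) t)))
    where
      open HS i
      finiteBlocks : Finite (Blocks b' μ')
      finiteBlocks = finiteΣ (finiteFin _) λ j → finiteΣ (finiteFin _) λ t → finiteFin _
      ≈? : ∀ {n} (x y : Str (H i) n) → Dec (_≈_ (H i) x y)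
      ≈? {n} x y = let (c , class , rep , class-cong , rep-class , _) = finite n in map′
        (λ e → ≈.trans (≈.sym (rep-class x)) (subst (λ z → _≈_ (H i) (rep z) y) (sym e) (rep-class y)))
        (class-cong x y) (Finite._≟_ (finiteFin c) (class x) (class y))

-- Height

cast↔ : ∀ {a b} → a ≡ b → Fin a ↔ Fin b
cast↔ refl = ↔-id _

fin? : ∀ n → Dec (Fin n)
fin? zero    = no λ ()
fin? (suc n) = yes zero

¬Fin⇒≡0 : ∀ n → ¬ Fin n → n ≡ 0
¬Fin⇒≡0 zero    _ = refl
¬Fin⇒≡0 (suc n) e = contradiction zero e

coverBelow : ∀ {D : Set} {h : D → ℕ} k → (∀ d → h d ≤ k) → Cover D ℕ (λ d c → h d ≡ c)
coverBelow {h = h} k h≤k = upTo (suc k) , λ d → h d , ∈-upTo⁺ (s≤s (h≤k d)) , refl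

module Height {m : ℕ} (H : Fin m → Species (suc m)) (isSpecies : ∀ i → IsSpecies (H i)) where
  open Trees H isSpecies

  -- Only nodes count and atoms have height 0, so that the bound `n` matches the `n`th iterate, with
  -- no node at all for `n = 0`.
  Height≤ : ℕ → ∀ {i k} → Tree i k → Set
  Height≤ n       (atom _)         = ⊤
  Height≤ zero    (node b μ p f g) = ⊥
  Height≤ (suc n) (node b μ p f g) = ∀ j t → Height≤ n (g j t)

  height-mono : ∀ {n n'} → n ≤ n' → ∀ {i k} (T : Tree i k) → Height≤ n T → Height≤ n' T
  height-mono _         (atom _)         _ = tt
  height-mono (s≤s n≤n') (node b μ p f g) h = λ j t → height-mono n≤n' (g j t) (h j t)

  height-het : ∀ n {i k k'} {σ : Fin k ↔ Fin k'} {T : Tree i k} {T'} → Het σ T T' → Height≤ n T → Height≤ n T'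
  height-het n       atom _ = tt
  height-het (suc n) (node {g' = g'} α f~ hs) h j t' =
    subst (λ t → Height≤ n (g' j t)) (strictlyInverseˡ (α j) t')
      (height-het n (proj₂ (proj₂ (hs j (from (α j) t')))) (h j (from (α j) t')))

  forget : ∀ n i {s} → Str (args (iter H n) i) s → Tree i (s zero)
  forget n       zero    e                = atom e
  forget (suc n) (suc i) (comp b μ p f g) =
    node b (λ j t → μ j t zero) (p zero) f (λ j t → forget n j (g j t))

  forget-height : ∀ n i {s} (x : Str (args (iter H n) i) s) → Height≤ n (forget n i x)
  forget-height n       zero    e                = tt
  forget-height (suc n) (suc i) (comp b μ p f g) = λ j t → forget-height n j (g j t)

  restrict : ∀ n {i s} (T : Tree i (s zero)) → Height≤ n T → Str (args (iter H n) i) s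
  restrict n       (atom e)         _ = e
  restrict (suc n) (node b μ p f g) h =
    comp b (λ j t _ → μ j t) (λ { zero → p }) f (λ j t → restrict n (g j t) (h j t))

  forget-restrict : ∀ n {i s} (T : Tree i (s zero)) (h : Height≤ n T) →
                    Het (↔-id _) (forget n i {s} (restrict n T h)) T
  forget-restrict n       (atom e)         _ = atom
  forget-restrict (suc n) {suc i} (node b μ p f g) h =
    het-node (strictlyInverseˡ p) ≈.refl (λ j t → forget-restrict n (g j t) (h j t))
    where open HS i

  -- The relabelling is arbitrary, because the recursion passes to the relabellings `ρ` of the
  -- blocks even when it starts from the identity.
  forget-het : ∀ n i {s s'} (σ : Relab s s') (x : Str (args (iter H n) i) s) (y : Str (args (iter H n) i) s') →
               _≈_ (args (iter H n) i) (tr (args (iter H n) i) σ x) y → Het (σ zero) (forget n i x) (forget n i y)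
  forget-het n       zero    σ x y _ = atom
  forget-het (suc n) (suc i) σ (comp b μ p f g) (comp b' μ' p' f' g') (α , ρ , e , f~ , h) =
    node α f~ λ j t → ρ j t zero ,
      (λ y → trans (e zero _) (cong (λ { (j , t , y) → j , to (α j) t , to (ρ j t zero) y })
               (trans (cong (to (p zero)) (strictlyInverseʳ (σ zero) _)) (strictlyInverseˡ (p zero) (j , t , y))))) ,
      forget-het n j (ρ j t) (g j t) (g' j (to (α j) t)) (h j t)

  forget-het⁻¹ : ∀ n i {s s'} (σ : Relab s s') (x : Str (args (iter H n) i) s) (y : Str (args (iter H n) i) s') →
                 Het (σ zero) (forget n i x) (forget n i y) → _≈_ (args (iter H n) i) (tr (args (iter H n) i) σ x) y
  forget-het⁻¹ n       zero    σ x y _ = tt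
  forget-het⁻¹ (suc n) (suc i) {s} {s'} σ (comp b μ p f g) (comp b' μ' p' f' g') (node α f~ h) =
    α , ρ , part , f~ , λ j t → forget-het⁻¹ n j (ρ j t) (g j t) (g' j (to (α j) t)) (proj₂ (proj₂ (h j t)))
    where
      ρ : ∀ j t → Relab (μ j t) (μ' j (to (α j) t))
      ρ j t zero = proj₁ (h j t)
      part : ∀ l x → to (p' l) x ≡ (let (j , t , y) = to (p l) (from (σ l) x)
                                    in (j , to (α j) t , to (ρ j t l) y))
      part zero x = let (j , t , y) = to (p zero) (from (σ zero) x) in
        trans (cong (to (p' zero)) (trans (sym (strictlyInverseˡ (σ zero) x))
                (cong (to (σ zero)) (sym (strictlyInverseʳ (p zero) _)))))
              (proj₁ (proj₂ (h j t)) y)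

  forget-cong : ∀ n i {s} (x y : Str (iter H n i) s) → _≈_ (iter H n i) x y →
                Het (↔-id _) (forget n (suc i) x) (forget n (suc i) y)
  forget-cong (suc n) i x@(comp _ _ _ _ _) y e = forget-het (suc n) (suc i) (λ _ → ↔-id _) x y e

  forget-reflects : ∀ n i {s} (x y : Str (iter H n i) s) →
                    Het (↔-id _) (forget n (suc i) x) (forget n (suc i) y) → _≈_ (iter H n i) x y
  forget-reflects (suc n) i x@(comp _ _ _ _ _) y h = forget-het⁻¹ (suc n) (suc i) (λ _ → ↔-id _) x y h

  treeSpecies : Fin m → Species 1
  treeSpecies i = record
    { Str = λ s → Tree (suc i) (s zero)
    ; _≈_ = Het (↔-id _)
    ; tr  = λ σ → trᵀ (σ zero) }

  -- Under `bound`, `restrict` applies to every tree with at most `p` labels and is there inverse to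
  -- `forget`.
  treeSpecies-contact : ∀ n p i → (∀ {k} → k ≤ p → (T : Tree (suc i) k) → Height≤ n T) →
                        Contact p (iter H n i) (treeSpecies i)
  treeSpecies-contact n p i bound = record
    { fwd      = λ s _ → forget n (suc i)
    ; bwd      = λ s q T → restrict n T (bound (size s q) T)
    ; fwd-cong = λ s _ → forget-cong n i _ _
    ; bwd-cong = λ s q {T} {T'} h → forget-reflects n i _ _
        (≈ᵀ.trans (forget-restrict n T _) (≈ᵀ.trans h (≈ᵀ.sym (forget-restrict n T' _))))
    ; bwd-fwd  = λ s q x → forget-reflects n i _ _ (forget-restrict n (forget n (suc i) x) _)
    ; fwd-bwd  = λ s q T → forget-restrict n T _
    ; natural  = λ s s' _ _ σ x → natural n σ x }
    where
      size : ∀ (s : Sizes 1) → ∑ s ≤ p → s zero ≤ p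
      size s = ℕP.≤-trans (ℕP.m≤m+n (s zero) 0)
      natural : ∀ n {s s'} (σ : Relab s s') (x : Str (iter H n i) s) →
                Het (↔-id _) (trᵀ (σ zero) (forget n (suc i) x)) (forget n (suc i) (tr (iter H n i) σ x))
      natural (suc n) σ (comp _ _ _ _ _) = ≈ᵀ.refl

  -- Finiteness of the trees of given size and bounded height

  module Finiteness (noEmpty : ∀ i {b} → (∀ j → b j ≡ 0) → ¬ Str (H i) b) where

    -- A node without blocks would carry an `H`-structure on the empty tuple, so one can always
    -- descend until an atom is reached.
    someLabel : ∀ {i k} → Tree i k → Fin k
    someLabel (atom refl) = zero
    someLabel {suc i} (node b μ p f g) with any? (λ j → fin? (b j))
    ... | yes (j , t) = from p (j , t , someLabel (g j t))
    ... | no none     = contradiction f (noEmpty i λ j → ¬Fin⇒≡0 (b j) λ t → none (j , t))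

    from-injective : ∀ {k b μ} (p : Fin k ↔ Blocks b μ) {z z'} → from p z ≡ from p z' → z ≡ z'
    from-injective p e = trans (sym (strictlyInverseˡ p _)) (trans (cong (to p) e) (strictlyInverseˡ p _))

    -- Picking one label in each block is injective.
    blockCount≤ : ∀ {k b μ} → Fin k ↔ Blocks b μ → (∀ j t → Tree j (μ j t)) → ∀ j → b j ≤ k
    blockCount≤ {k} {b} p g j = injective⇒≤ {f = λ t → from p (j , t , someLabel (g j t))}
      λ e → same (from-injective p e)
      where
        same : ∀ {t t' y y'} → _≡_ {A = Blocks b _} (j , t , y) (j , t' , y') → t ≡ t'
        same refl = refl

    blockSize≤ : ∀ {k b μ} → Fin k ↔ Blocks b μ → ∀ j t → μ j t ≤ k
    blockSize≤ {b = b} p j t = injective⇒≤ {f = λ y → from p (j , t , y)} λ e → same (from-injective p e)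
      where
        same : ∀ {t y y'} → _≡_ {A = Blocks b _} (j , t , y) (j , t , y') → y ≡ y'
        same refl = refl

    -- Nodes are enumerated by block counts, block sizes, partition, root structure and subtrees, in
    -- this order. `coverNode` makes the last three choices for fixed counts and sizes;
    -- `coverBounded` adds the first two.
    module CoverNodes (n : ℕ) (i : Fin m) (k : ℕ)
      (coverChild : ∀ j l → Cover (Σ (Tree j l) (Height≤ n)) (Tree j l) (λ T T' → Het (↔-id _) (proj₁ T) T')) where
      open HS i

      record Node (b : Sizes (suc m)) (μ : ∀ j → Fin (b j) → ℕ) : Set where
        constructor mkNode
        field
          parts    : Fin k ↔ Blocks b μ
          shape    : Str (H i) b
          children : ∀ j t → Σ (Tree j (μ j t)) (Height≤ n)

        tree : Tree (suc i) k
        tree = node b μ parts shape (λ j t → proj₁ (children j t))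

      open Node

      coverStr : ∀ b → Cover (Str (H i) b) (Str (H i) b) (_≈_ (H i))
      coverStr b = let (c , class , rep , class-cong , rep-class , _) = finite b in
        restrictCover {U' = λ x z → class x ≡ z} class (λ _ _ e → e) (Finite.elements (finiteFin c)) >>= λ z →
        coverOne (rep z) λ { (x , refl) → ≈.sym (rep-class x) }

      coverChildren : ∀ b μ → Cover (Node b μ) (∀ j t → Tree j (μ j t))
                        (λ N g → ∀ j t → Het (↔-id _) (proj₁ (children N j t)) (g j t))
      coverChildren b μ = chooseFin (suc m) λ j → chooseFin (b j) λ t →
        restrictCover (λ N → children N j t) (λ _ _ h → h) (coverChild j (μ j t))

      coverNode : ∀ b μ → Cover (Node b μ) (Tree (suc i) k) (λ N T → Het (↔-id _) (tree N) T)
      coverNode b μ =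
        restrictCover {U' = λ N p → ∀ x → to (parts N) x ≡ to p x} parts (λ _ _ e → e)
          (finite↔ (finiteFin k) (finiteΣ (finiteFin _) λ j → finiteΣ (finiteFin _) λ t → finiteFin _)) >>= λ p →
        restrictCover {U' = λ N f → _≈_ (H i) (shape (proj₁ N)) f} (λ N → shape (proj₁ N)) (λ _ _ e → e)
          (coverStr b) >>= λ f →
        restrictCover {U' = λ N g → ∀ j t → Het (↔-id _) (proj₁ (children (proj₁ (proj₁ N)) j t)) (g j t)}
          (λ N → proj₁ (proj₁ N)) (λ _ _ e → e) (coverChildren b μ) >>= λ g →
        coverOne (node b μ p f g) λ { (((N , ep) , ef) , eg) →
          het-node (λ z → trans (sym (ep _)) (strictlyInverseˡ (parts N) z)) ef eg }

      Bounded : Set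
      Bounded = Σ (Sizes (suc m)) λ b → Σ (∀ j → Fin (b j) → ℕ) λ μ → Node b μ

      boundedTree : Bounded → Tree (suc i) k
      boundedTree (b , μ , N) = tree N

      WithCounts : Sizes (suc m) → Set
      WithCounts b' = Σ Bounded λ { (b , _) → ∀ j → b j ≡ b' j }

      sizeAt : ∀ {b'} → WithCounts b' → ∀ j → Fin (b' j) → ℕ
      sizeAt ((b , μ , N) , e) j t = μ j (to (cast↔ (sym (e j))) t)

      module _ {b' : Sizes (suc m)} {μ' : ∀ j → Fin (b' j) → ℕ} where

        -- The enumerated `b'` and `μ'` agree with those of the node only pointwise, so the node is
        -- moved to them by relabelling along `cast↔` instead of by substitution.
        normalise : (Σ (WithCounts b') λ T → ∀ j t → sizeAt T j t ≡ μ' j t) → Node b' μ'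
        normalise (((b , μ , N) , e) , e') = mkNode
          (relabelParts (λ j → cast↔ (sym (e j))) (λ j t → cast↔ (sym (e' j t))) (parts N))
          (tr (H i) (λ j → ↔-sym (cast↔ (sym (e j)))) (shape N))
          (λ j t → let (T , h) = children N j (to (cast↔ (sym (e j))) t) in
            trᵀ (↔-sym (cast↔ (sym (e' j t)))) T , height-het n (het-tr _ T) h)

        normalise-het : ∀ T → Het (↔-id _) (boundedTree (proj₁ (proj₁ T))) (tree (normalise T))
        normalise-het (((b , μ , N) , e) , e') =
          ≈ᵀ.sym
            (relabel (parts N) (shape N) (λ j t → proj₁ (children N j t))
              (λ j → cast↔ (sym (e j))) (λ j t → cast↔ (sym (e' j t))))

      coverBounded : Cover Bounded (Tree (suc i) k) (λ N T → Het (↔-id _) (boundedTree N) T)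
      coverBounded =
        chooseFin (suc m) (λ j → coverBelow k λ { (b , μ , N) →
          blockCount≤ (parts N) (λ j t → proj₁ (children N j t)) j }) >>= λ b' →
        sizes b' >>= λ μ' →
        restrictCover normalise (λ T T' h → ≈ᵀ.trans (normalise-het T) h) (coverNode b' μ')
        where
          sizes : ∀ b' → Cover (WithCounts b') (∀ j → Fin (b' j) → ℕ) (λ T μ' → ∀ j t → sizeAt T j t ≡ μ' j t)
          sizes b' = chooseFin (suc m) λ j → chooseFin (b' j) λ t →
            coverBelow k λ { ((b , μ , N) , e) → blockSize≤ (parts N) j _ }

    coverTree : ∀ n i k → Cover (Σ (Tree i k) (Height≤ n)) (Tree i k) (λ T T' → Het (↔-id _) (proj₁ T) T')
    coverTree n zero k with k ℕP.≟ 1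
    ... | yes k≡1 = coverOne (atom k≡1) λ { (atom _ , _) → atom }
    ... | no k≢1  = coverNone λ { (atom k≡1 , _) → k≢1 k≡1 }
    coverTree zero    (suc i) k = coverNone λ { (node _ _ _ _ _ , ()) }
    coverTree (suc n) (suc i) k = restrictCover
      (λ { (node b μ p f g , h) → b , μ , mkNode p f (λ j t → g j t , h j t) })
      (λ { (node b μ p f g , h) T' e → e }) coverBounded
      where open CoverNodes n i k (coverTree n)

    treeSpecies-isSpecies : ∀ i → (∀ k → ∃ λ n → ∀ T → Height≤ n {suc i} {k} T) → IsSpecies (treeSpecies i)
    treeSpecies-isSpecies i bound = record
      { equiv   = λ s → het-equiv
      ; tr-cong = λ σ {T} {T'} h → het-trans {τ = σ zero} (λ x → sym (strictlyInverseˡ (σ zero) x))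
                    (het-sym {τ = ↔-sym (σ zero)} (strictlyInverseʳ (σ zero)) (het-tr (σ zero) T))
                    (het-trans (λ _ → refl) h (het-tr (σ zero) T'))
      ; tr-id   = λ σ e T → het-sym (e zero) (het-tr (σ zero) T)
      ; tr-comp = λ σ τ ρ e T → het-trans {τ = ρ zero} (λ x → sym (strictlyInverseˡ (ρ zero) x))
                    (het-sym {τ = ↔-sym (ρ zero)} (strictlyInverseʳ (ρ zero)) (het-tr (ρ zero) T))
                    (het-trans (e zero) (het-tr (σ zero) T) (het-tr (τ zero) _))
      ; finite  = λ s → finiteQuotient het-equiv (het? (↔-id _))
                    (let (n , h) = bound (s zero) in restrictCover (λ T → T , h T) (λ _ _ e → e) (coverTree n (suc i) (s zero))) }

-- The graph of the Jacobian

empty⇒≅𝟘 : ∀ {k} {F : Species k} → (∀ s → ¬ Str F s) → F ≅ 𝟘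
empty⇒≅𝟘 empty = record
  { fwd      = λ s _ x → empty s x
  ; bwd      = λ _ _ ()
  ; fwd-cong = λ _ _ _ → tt
  ; bwd-cong = λ { _ _ {()} }
  ; bwd-fwd  = λ s _ x → contradiction x (empty s)
  ; fwd-bwd  = λ _ _ ()
  ; natural  = λ _ _ _ _ _ _ → tt }

≅𝟘⇒empty : ∀ {k} {F : Species k} → F ≅ 𝟘 → ∀ s → ¬ Str F s
≅𝟘⇒empty iso s x = IsoOn.fwd iso s tt x

Σˢ-in : ∀ {k m} (F : Fin m → Species k) l {s} → Str (F l) s → Str (Σˢ F) s
Σˢ-in F zero    x = inj₁ x
Σˢ-in F (suc l) x = inj₂ (Σˢ-in (F ∘ suc) l x)

Σˢ-out : ∀ {k m} (F : Fin m → Species k) {s} → Str (Σˢ F) s → ∃ λ l → Str (F l) s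
Σˢ-out {m = suc m} F (inj₁ x) = zero , x
Σˢ-out {m = suc m} F (inj₂ x) = let (l , y) = Σˢ-out (F ∘ suc) x in suc l , y

∑↔Σ : ∀ n (c : Fin n → ℕ) → Fin (∑ c) ↔ Σ (Fin n) (λ i → Fin (c i))
∑↔Σ zero    c = mk↔ₛ′ (λ ()) (λ ()) (λ ()) (λ ())
∑↔Σ (suc n) c = mk↔ₛ′ f g fg gf ↔-∘ +↔⊎
  where
    rest : Fin (∑ (c ∘ suc)) ↔ Σ (Fin n) (λ i → Fin (c (suc i)))
    rest = ∑↔Σ n (c ∘ suc)
    f : Fin (c zero) ⊎ Fin (∑ (c ∘ suc)) → Σ (Fin (suc n)) (λ i → Fin (c i))
    f (inj₁ x) = zero , x
    f (inj₂ y) = let (i , x) = to rest y in suc i , x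
    g : Σ (Fin (suc n)) (λ i → Fin (c i)) → Fin (c zero) ⊎ Fin (∑ (c ∘ suc))
    g (zero  , x) = inj₁ x
    g (suc i , x) = inj₂ (from rest (i , x))
    fg : ∀ z → f (g z) ≡ z
    fg (zero  , x) = refl
    fg (suc i , x) = cong (λ { (i , x) → suc i , x }) (strictlyInverseˡ rest (i , x))
    gf : ∀ z → g (f z) ≡ z
    gf (inj₁ x) = refl
    gf (inj₂ y) = cong inj₂ (strictlyInverseʳ rest y)

-- Double-negation shift for a finite index set: towards a negative goal, finitely many undecided
-- cases may be taken as decided together.
¬¬-∀Fin : ∀ n {P : Fin n → Set} → (∀ i → ¬ ¬ P i) → ¬ ¬ (∀ i → P i)
¬¬-∀Fin zero    nn k = k λ ()
¬¬-∀Fin (suc n) nn k = nn zero λ p → ¬¬-∀Fin n (nn ∘ suc) λ ps → k λ { zero → p ; (suc i) → ps i }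

∀⊎⇒∀⊎∃ : ∀ n {P Q : Fin n → Set} → (∀ i → P i ⊎ Q i) → (∀ i → P i) ⊎ ∃ Q
∀⊎⇒∀⊎∃ zero    c = inj₁ λ ()
∀⊎⇒∀⊎∃ (suc n) c with c zero | ∀⊎⇒∀⊎∃ n (c ∘ suc)
... | inj₂ q | _            = inj₂ (zero , q)
... | inj₁ _ | inj₂ (i , q) = inj₂ (suc i , q)
... | inj₁ p | inj₁ ps      = inj₁ λ { zero → p ; (suc i) → ps i }

-- If P gained some i at each of the steps 0, …, m, two of these i would coincide.
stabilises : ∀ m (P : ℕ → Fin m → Set) → (∀ {l n i} → l ≤ n → P l i → P n i) →
             ¬ ¬ (∃ λ l → l ≤ m × (∀ i → P (suc l) i → P l i))
stabilises m P mono none = ¬¬-∀Fin (suc m) (λ l → ¬¬-∀Fin m (new⊎old (toℕ l))) λ cases →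
  finish (∀⊎⇒∀⊎∃ (suc m) (λ l → swap (∀⊎⇒∀⊎∃ m (cases l))))
  where
    New : ℕ → Fin m → Set
    New l i = P (suc l) i × ¬ P l i
    new⊎old : ∀ l i → ¬ ¬ ((P (suc l) i → P l i) ⊎ New l i)
    new⊎old l i k = k (inj₁ λ q → contradiction (inj₂ (q , λ p → k (inj₁ λ _ → p))) k)
    finish : ¬ ((∀ (l : Fin (suc m)) → ∃ (New (toℕ l)))
                ⊎ (∃ λ (l : Fin (suc m)) → ∀ i → P (suc (toℕ l)) i → P (toℕ l) i))
    finish (inj₂ (l , stable)) = none (toℕ l , toℕ≤pred[n] l , stable)
    finish (inj₁ new) with pigeonhole (ℕP.n<1+n m) (λ l → proj₁ (new l))
    ... | l , l' , l<l' , same =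
      proj₂ (proj₂ (new l')) (mono l<l' (subst (P (suc (toℕ l))) same (proj₁ (proj₂ (new l)))))

-- This and the next two facts say that bumping the zero tuple at a sort creates a label there, none
-- at another sort, and only one.
bumpLabel : ∀ {A : Set} (d : Dec A) → A → Fin (bumpD d 0)
bumpLabel (yes _) _ = zero
bumpLabel (no ¬a) a = contradiction a ¬a

bumpSource : ∀ {A : Set} (d : Dec A) → Fin (bumpD d 0) → A
bumpSource (yes a) _ = a

bumpUnique : ∀ {A : Set} (d : Dec A) (t t' : Fin (bumpD d 0)) → t ≡ t'
bumpUnique (yes _) zero zero = refl

module Graph {m : ℕ} (H : Fin m → Species (suc m)) (isSpecies : ∀ i → IsSpecies (H i)) where
  open Trees H isSpecies
  open Height H isSpecies

  Edge : Fin m → Fin m → Set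
  Edge i j = Str (H i) (bump (suc j) (λ _ → 0))

  edge? : ∀ i j → Dec (Edge i j)
  edge? i j with HS.finite i (bump (suc j) (λ _ → 0))
  ... | zero  , class , _       = no λ e → contradiction (class e) λ ()
  ... | suc _ , _     , rep , _ = yes (rep zero)

  Walk : ℕ → Fin m → Fin m → Set
  Walk zero    i j = i ≡ j
  Walk (suc r) i j = ∃ λ l → Edge i l × Walk r l j

  walk? : ∀ r i j → Dec (Walk r i j)
  walk? zero    i j = i Fin.≟ j
  walk? (suc r) i j = any? λ l → edge? i l ×-dec walk? r l j

  -- Expanding the power as a sum over the next vertex, a structure is an edge followed by a walk;
  -- everything lives on the empty tuple, where the splitting is trivial.
  walk⇒power : ∀ r i j → Walk r i j → Str ((jacobian0 H ^ᴹ r) i j) (λ _ → 0)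
  walk⇒power zero i i refl with i Fin.≟ i
  ... | yes _  = λ _ → refl
  ... | no i≢i = contradiction refl i≢i
  walk⇒power (suc r) i j (l , e , w) = Σˢ-in (λ l → jacobian0 H i l ⊗ (jacobian0 H ^ᴹ r) l j) l
    (prod _ _ (λ _ → +↔⊎ {0} {0}) ((λ _ → refl) , e) (walk⇒power r l j w))

  power⇒walk : ∀ r i j {s} → Str ((jacobian0 H ^ᴹ r) i j) s → Walk r i j
  power⇒walk zero i j x with i Fin.≟ j
  ... | yes i≡j = i≡j
  power⇒walk (suc r) i j x with Σˢ-out (λ l → jacobian0 H i l ⊗ (jacobian0 H ^ᴹ r) l j) x
  ... | l , prod a b _ (a≡0 , e) y =
    -- `a` vanishes only pointwise, hence the transport to the zero tuple.
    l , tr (H i) (λ h → cast↔ (cong (bumpD (suc l Fin.≟ h)) (a≡0 h))) e , power⇒walk r l j y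

  vertex : ∀ r {i j} → Walk r i j → Fin (suc r) → Fin m
  vertex r       {i} w           zero    = i
  vertex (suc r)     (_ , _ , w) (suc a) = vertex r w a

  prefix : ∀ r {i j} (w : Walk r i j) a → Walk (toℕ a) i (vertex r w a)
  prefix r       w           zero    = refl
  prefix (suc r) (l , e , w) (suc a) = l , e , prefix r w a

  segment : ∀ r {i j} (w : Walk r i j) a b → a Fin.< b → ∃ λ r' → Walk (suc r') (vertex r w a) (vertex r w b)
  segment r       w           zero    (suc b) _         = toℕ b , prefix r w (suc b)
  segment (suc r) (_ , _ , w) (suc a) (suc b) (s≤s a<b) = segment r w a b a<b

  -- A walk of length `m` visits `m + 1` vertices, two of which coincide; the segment between them
  -- is closed and nonempty.
  cycle : ∀ {i j} → Walk m i j → ∃ λ v → ∃ λ r → Walk (suc r) v v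
  cycle w with pigeonhole (ℕP.n<1+n m) (vertex m w)
  ... | a , b , a<b , same = vertex m w a ,
    let (r , s) = segment m w a b a<b in r , subst (Walk (suc r) (vertex m w a)) (sym same) s

  -- The edge structure has a single block; placing `T` there raises the height by one and adds no
  -- label.
  graft : ∀ {i j k} → Edge i j → Tree (suc j) k → Tree (suc i) k
  graft {i} {j} {k} e T = node (bump (suc j) (λ _ → 0)) (λ _ _ → k)
    (mk↔ₛ′ (λ x → suc j , bumpLabel (suc j Fin.≟ suc j) refl , x) (λ { (_ , _ , x) → x })
      (λ { (l , t , x) → only t (bumpSource (suc j Fin.≟ l) t) }) (λ _ → refl))
    e (λ l t → subst (λ l → Tree l k) (bumpSource (suc j Fin.≟ l) t) T)
    where
      only : ∀ {l x} (t : Fin (bump (suc j) (λ _ → 0) l)) → suc j ≡ l →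
             _≡_ {A = Blocks (bump (suc j) (λ _ → 0)) (λ _ _ → k)}
                 (suc j , bumpLabel (suc j Fin.≟ suc j) refl , x) (l , t , x)
      only {x = x} t refl = cong (λ t → suc j , t , x) (bumpUnique (suc j Fin.≟ suc j) _ t)

  height-graft : ∀ {n i j k} (e : Edge i j) (T : Tree (suc j) k) → Height≤ n T → Height≤ (suc n) (graft e T)
  height-graft {n} {j = j} {k} e T h l t = transported (bumpSource (suc j Fin.≟ l) t)
    where
      transported : ∀ {l} (e : suc j ≡ l) → Height≤ n (subst (λ l → Tree l k) e T)
      transported refl = h

  height-graft⁻¹ : ∀ {n i j k} (e : Edge i j) (T : Tree (suc j) k) → Height≤ (suc n) (graft e T) → Height≤ n T
  height-graft⁻¹ {n} {j = j} {k} e T h =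
    transported (bumpSource (suc j Fin.≟ suc j) star) (h (suc j) star)
    where
      star : Fin (bump (suc j) (λ _ → 0) (suc j))
      star = bumpLabel (suc j Fin.≟ suc j) refl
      transported : (e : suc j ≡ suc j) → Height≤ n (subst (λ l → Tree l k) e T) → Height≤ n T
      transported refl h = h

  graftWalk : ∀ r {i j k} → Walk r i j → Tree (suc j) k → Tree (suc i) k
  graftWalk zero    refl        T = T
  graftWalk (suc r) (_ , e , w) T = graft e (graftWalk r w T)

  height-graftWalk : ∀ r {n i j k} (w : Walk r i j) (T : Tree (suc j) k) →
                     Height≤ n T → Height≤ (r + n) (graftWalk r w T)
  height-graftWalk zero    refl        T h = h
  height-graftWalk (suc r) (_ , e , w) T h = height-graft e _ (height-graftWalk r w T h)

  height-graftWalk⁻¹ : ∀ r {n i j k} (w : Walk r i j) (T : Tree (suc j) k) →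
                       Height≤ (r + n) (graftWalk r w T) → Height≤ n T
  height-graftWalk⁻¹ zero    refl        T h = h
  height-graftWalk⁻¹ (suc r) (_ , e , w) T h = height-graftWalk⁻¹ r w T (height-graft⁻¹ e _ h)

  -- Pumping a tree around a cycle

  module Pumping {v r} (w : Walk (suc r) v v) {k} (T : Tree (suc v) k) where

    pump : ℕ → Tree (suc v) k
    pump zero    = T
    pump (suc a) = graftWalk (suc r) w (pump a)

    height-pump : ∀ a {n} → Height≤ n T → Height≤ (a * suc r + n) (pump a)
    height-pump zero    h = h
    height-pump (suc a) {n} h = subst (λ l → Height≤ l (pump (suc a))) (sym (ℕP.+-assoc (suc r) (a * suc r) n))
      (height-graftWalk (suc r) w (pump a) (height-pump a h))

    height-pump⁻¹ : ∀ a {n} → Height≤ (a * suc r + n) (pump a) → Height≤ n T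
    height-pump⁻¹ zero    h = h
    height-pump⁻¹ (suc a) {n} h = height-pump⁻¹ a (height-graftWalk⁻¹ (suc r) w (pump a)
      (subst (λ l → Height≤ l (pump (suc a))) (ℕP.+-assoc (suc r) (a * suc r) n) h))

    -- An isomorphism would let the height bound n of T be lowered to n - 1, and so down to 0.
    pump-distinct : ∀ {a b n} → a < b → Height≤ n T → ¬ Het (↔-id _) (pump a) (pump b)
    pump-distinct {a} {b} {zero} a<b h het = height0 T h
      where
        height0 : ∀ {i k} (T : Tree (suc i) k) → ¬ Height≤ 0 T
        height0 (node _ _ _ _ _) ()
    pump-distinct {a} {b} {suc n} a<b h het = pump-distinct {n = n} a<b (height-pump⁻¹ b
      (height-mono larger (pump b) (height-het (a * suc r + suc n) het (height-pump a h)))) het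
      where
        open ℕP.≤-Reasoning
        larger : a * suc r + suc n ≤ b * suc r + n
        larger = begin
          a * suc r + suc n     ≡⟨ ℕP.+-suc (a * suc r) n ⟩
          suc (a * suc r) + n   ≤⟨ ℕP.+-monoˡ-≤ n (s≤s (ℕP.m≤n+m (a * suc r) r)) ⟩
          suc a * suc r + n     ≤⟨ ℕP.+-monoˡ-≤ n (ℕP.*-monoˡ-≤ (suc r) a<b) ⟩
          b * suc r + n         ∎

  -- Stationarity of the set of nonzero coordinates

  Inhabited : ℕ → Fin m → Set
  Inhabited n i = ∃ λ k → Σ (Tree (suc i) k) (Height≤ n)

  -- From the leaves upward: once the subtrees have height at most `l`, the node has height at most
  -- `l + 1`, and `stable` supplies one of height at most `l`. Subtree sizes may change, so the
  -- label set is rebuilt as a disjoint union with `∑↔Σ`.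
  prune : ∀ {l} → (∀ i → Inhabited (suc l) i → Inhabited l i) → ∀ {i k} → Tree (suc i) k → Inhabited l i
  prune {l} stable {i} (node b μ p f g) = stable i
    (_ , node b _ (Σ-cong (↔-id _) (λ {j} → ∑↔Σ (b j) (λ t → proj₁ (child j t))) ↔-∘ ∑↔Σ (suc m) _) f
           (λ j t → proj₁ (proj₂ (child j t))) , λ j t → proj₂ (proj₂ (child j t)))
    where
      prune′ : ∀ {j k} → Tree j k → ∃ λ k' → Σ (Tree j k') (Height≤ l)
      prune′ (atom e)            = _ , atom e , tt
      prune′ T@(node _ _ _ _ _)  = prune stable T
      child : ∀ j t → ∃ λ k' → Σ (Tree j k') (Height≤ l)
      child j t = prune′ (g j t)

  tree⇒inhabited : ∀ {i k} → Tree (suc i) k → ¬ ¬ Inhabited m i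
  tree⇒inhabited T none = stabilises m Inhabited (λ { l≤n (k , T , h) → k , T , height-mono l≤n T h })
    λ { (l , l≤m , stable) → let (k , T' , h) = prune stable T in none (k , T' , height-mono l≤m T' h) }

  -- Nilpotency bounds the height by the size

  module HeightBound (noEmpty : ∀ i {b} → (∀ j → b j ≡ 0) → ¬ Str (H i) b)
                     (q : ℕ) (noWalk : ∀ i j → ¬ Walk q i j) where
    open Finiteness noEmpty

    -- When `t` is the only block, `b` is in bijection with the one-label tuple of sort `suc j`, and
    -- the root structure can be transported there.
    loneBlock⇒edge : ∀ {i j b} (t : Fin (b (suc j))) →
                     (∀ z → z ≡ (suc j , t)) → Str (H i) b → Edge i j
    loneBlock⇒edge {i} {j} {b} t only = tr (H i) λ l → mk↔ₛ′
      (λ u → bumpLabel (suc j Fin.≟ l) (sym (cong proj₁ (only (l , u)))))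
      (λ u → subst (Fin ∘ b) (bumpSource (suc j Fin.≟ l) u) t)
      (λ u → bumpUnique (suc j Fin.≟ l) _ u)
      (λ u → unique (trans (only (l , _)) (sym (only (l , u)))))
      where
        unique : ∀ {l} {u u' : Fin (b l)} → _≡_ {A = Σ (Fin (suc m)) (Fin ∘ b)} (l , u) (l , u') → u ≡ u'
        unique refl = refl

    -- If there is a block other than `t`, one of its labels and all those of `t` inject into the
    -- `k` labels; otherwise `t` is the lone block.
    smaller⊎edge : ∀ {i k b μ} → Fin k ↔ Blocks b μ → Str (H i) b → (∀ j t → Tree j (μ j t)) →
                   ∀ j t → μ (suc j) t < k ⊎ Edge i j
    smaller⊎edge {k = k} {b} {μ} p f g j t =
      decide (search elements (λ { refl e → e }) (λ z → ¬? (z ≟ (suc j , t))))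
      where
        open Finite (finiteΣ (finiteFin (suc m)) (λ l → finiteFin (b l)))
        decide : Dec (∃ λ z → ¬ (z ≡ (suc j , t))) → μ (suc j) t < k ⊎ Edge _ j
        decide (no none) = inj₂ (loneBlock⇒edge t
          (λ z → decidable-stable (z ≟ (suc j , t)) (λ z≢ → none (z , z≢))) f)
        decide (yes ((l , u) , z≢)) = inj₁ (injective⇒≤ {f = label} injective)
          where
            label : Fin (suc (μ (suc j) t)) → Fin k
            label zero    = from p (l , u , someLabel (g l u))
            label (suc y) = from p (suc j , t , y)
            block : Blocks b μ → Σ (Fin (suc m)) (Fin ∘ b)
            block (l , u , _) = l , u
            same : ∀ {y y'} → _≡_ {A = Blocks b μ} (suc j , t , y) (suc j , t , y') → y ≡ y'
            same refl = refl
            injective : ∀ {y y'} → label y ≡ label y' → y ≡ y'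
            injective {zero}  {zero}   _ = refl
            injective {zero}  {suc y'} e = contradiction (cong block (from-injective p e)) z≢
            injective {suc y} {zero}   e = contradiction (cong block (from-injective p (sym e))) z≢
            injective {suc y} {suc y'} e = cong suc (same (from-injective p e))

    -- `r` is the allowance of edges before a label must be lost. Following an edge uses one up;
    -- losing a label resets the allowance to `q`.
    height-bound : ∀ r {i k} (T : Tree (suc i) k) → (∀ j → ¬ Walk r i j) → Height≤ (r + q * k) T
    height-bound zero    T short = contradiction refl (short _)
    height-bound (suc r) {i} {k} (node b μ p f g) short = bounded
      where
        atomic : ∀ {n l} (T : Tree zero l) → Height≤ n T
        atomic (atom _) = tt
        bounded : ∀ j t → Height≤ (r + q * k) (g j t)
        bounded zero    t = atomic (g zero t)
        bounded (suc j) t with smaller⊎edge p f g j t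
        -- With `μ` the size of the subtree, the lost label pays for the reset:
        -- `q + q * μ = q * (μ + 1) ≤ q * k`.
        ... | inj₁ μ<k = height-mono
          (ℕP.≤-trans (ℕP.≤-reflexive (sym (ℕP.*-suc q _))) (ℕP.≤-trans (ℕP.*-monoʳ-≤ q μ<k) (ℕP.m≤n+m _ r)))
          (g (suc j) t) (height-bound q (g (suc j) t) (noWalk j))
        ... | inj₂ e   = height-mono
          (ℕP.+-monoʳ-≤ r (ℕP.*-monoʳ-≤ q (blockSize≤ p (suc j) t)))
          (g (suc j) t) (height-bound r (g (suc j) t) (λ l w → short l (j , e , w)))

-- The two implications

module _ {m : ℕ} (H : Fin m → Species (suc m)) (isSpecies : ∀ i → IsSpecies (H i)) where
  open Trees H isSpecies
  open Height H isSpecies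
  open Graph H isSpecies

  module WellFounded (Y : Fin m → Species 1) (Y-isSpecies : ∀ i → IsSpecies (Y i))
                     (converges : Converges (iter H) Y) (nonzero : NoZeroCoord Y) where

    -- A nonzero coordinate yields a tree only under double negation, which is enough for the
    -- negative goals below. By contact, a structure of the limit comes from an iterate, hence from
    -- a tree.
    noTree⇒⊥ : ∀ i → ¬ (∀ k n (T : Tree (suc i) k) → ¬ Height≤ n T)
    noTree⇒⊥ i noTree = nonzero i (empty⇒≅𝟘 λ s y →
      let (N , contact) = converges i (∑ s)
          x = IsoOn.bwd (contact N ℕP.≤-refl) s ℕP.≤-refl y
      in noTree _ N (forget N (suc i) x) (forget-height N (suc i) x))

    iterate-nonzero : NoZeroCoord (iter H m)
    iterate-nonzero i iter≅𝟘 = noTree⇒⊥ i λ k n T _ → tree⇒inhabited T λ { (l , T' , h) →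
      ≅𝟘⇒empty iter≅𝟘 (λ _ → l) (restrict m T' h) }

    -- Among `c + 1` pumped trees of one size, two fall into the same of the `c` classes of `Y v`;
    -- pulled back through the contact they are isomorphic, against `pump-distinct`.
    noCycle : ∀ {v r} → ¬ Walk (suc r) v v
    noCycle {v} {r} w = noTree⇒⊥ v λ k n T h →
      let open Pumping {r = r} w T
          s : Sizes 1
          s = λ _ → k
          (N , contacts) = converges v (∑ s)
          (c , class , rep , _ , rep-class , _) = IsSpecies.finite (Y-isSpecies v) s
          -- Late enough for contact, and high enough for the tallest tree, pumped `c` times.
          M = N ⊔ (c * suc r + n)
          open IsoOn (contacts M (ℕP.m≤m⊔n N _))
          height : ∀ a → Height≤ M (pump (toℕ a))
          height = λ (a : Fin (suc c)) → height-mono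
            (ℕP.≤-trans (ℕP.+-monoˡ-≤ n (ℕP.*-monoˡ-≤ (suc r) (toℕ≤pred[n] a))) (ℕP.m≤n⊔m N _))
            (pump (toℕ a)) (height-pump (toℕ a) h)
          x : Fin (suc c) → Str (iter H M v) s
          x = λ a → restrict M (pump (toℕ a)) (height a)
          y : Fin (suc c) → Str (Y v) s
          y = λ a → fwd s ℕP.≤-refl (x a)
          (a , b , a<b , same) = pigeonhole (ℕP.n<1+n c) (λ a → class (y a))
          module ≈ = IsEquivalence (IsSpecies.equiv (Y-isSpecies v) s)
          ya≈yb : _≈_ (Y v) (y a) (y b)
          ya≈yb = ≈.trans (≈.sym (rep-class (y a)))
                    (subst (λ z → _≈_ (Y v) (rep z) (y b)) (sym same) (rep-class (y b)))
          forget-bwd : ∀ a → Het (↔-id _) (forget M (suc v) (bwd s ℕP.≤-refl (y a))) (pump (toℕ a))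
          forget-bwd = λ a → ≈ᵀ.trans
            (forget-cong M v _ _ (bwd-fwd s ℕP.≤-refl (x a))) (forget-restrict M (pump (toℕ a)) (height a))
      in pump-distinct a<b h (≈ᵀ.trans (≈ᵀ.sym (forget-bwd a))
           (≈ᵀ.trans (forget-cong M v _ _ (bwd-cong s ℕP.≤-refl ya≈yb)) (forget-bwd b)))

    -- The exponent `m` works: a structure in the `m`th power would give a walk of length `m`, which
    -- contains a cycle.
    jacobian-nilpotent : Nilpotent (jacobian0 H)
    jacobian-nilpotent with any? (λ i → any? (λ j → walk? m i j))
    ... | no none         = m , λ i j → empty⇒≅𝟘 λ s x → none (i , j , power⇒walk m i j x)
    ... | yes (i , j , w) = let (v , r , c) = cycle w in contradiction c (noCycle {v} {r})

  module NilpotentJacobian (noEmpty : ∀ i {b} → (∀ j → b j ≡ 0) → ¬ Str (H i) b)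
                           (q : ℕ) (Jq≅𝟘 : ∀ i j → (jacobian0 H ^ᴹ q) i j ≅ 𝟘)
                           (nonzero : NoZeroCoord (iter H m)) where
    open Finiteness noEmpty
    open HeightBound noEmpty q (λ i j w → ≅𝟘⇒empty (Jq≅𝟘 i j) _ (walk⇒power q i j w))

    -- The allowance starts at `q`, as a walk of length `q` would be a structure of the zero matrix
    -- `J^q`.
    bound : ∀ i {k p n} → k ≤ p → q + q * p ≤ n → (T : Tree (suc i) k) → Height≤ n T
    bound i k≤p p≤n T = height-mono (ℕP.≤-trans (ℕP.+-monoʳ-≤ q (ℕP.*-monoʳ-≤ q k≤p)) p≤n) T
      (height-bound q T (λ j w → ≅𝟘⇒empty (Jq≅𝟘 i j) _ (walk⇒power q i j w)))

    wellFounded : WellFoundedAt0 H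
    wellFounded = treeSpecies ,
      (λ i → treeSpecies-isSpecies i (λ k → q + q * k , bound i ℕP.≤-refl ℕP.≤-refl)) ,
      (λ i p → q + q * p , λ n p≤n → treeSpecies-contact n p i (λ k≤p → bound i k≤p p≤n)) ,
      (λ i tree≅𝟘 → nonzero i (empty⇒≅𝟘 λ s x → ≅𝟘⇒empty tree≅𝟘 s (forget m (suc i) x)))

mainTheorem1 : ∀ (m : ℕ) (H : Fin m → Species (suc m)) →
    (∀ i → IsSpecies (H i)) →
    (∀ i → at0 (H i) ≅ 𝟘) →
    WellFoundedAt0 H ⇔ (Nilpotent (jacobian0 H) × NoZeroCoord (iter H m))
mainTheorem1 m H isSpecies H0 = mk⇔
  (λ (Y , Y-isSpecies , converges , nonzero) →
    let open WellFounded H isSpecies Y Y-isSpecies converges nonzero in jacobian-nilpotent , iterate-nonzero)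
  (λ ((q , Jq≅𝟘) , nonzero) → NilpotentJacobian.wellFounded H isSpecies
    (λ i b≡0 f → ≅𝟘⇒empty (H0 i) _ (b≡0 , f)) q Jq≅𝟘 nonzero)
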